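{- Let $p,q\in\mathbb{N}$ be coprime, $k\in\mathbb{N}$ squarefree, $m=-pk$, $n=qk$. (i) If the quadratic forms $X^2+mY^2$ and $X^2+nY^2$ are concordant due to $4$- or $8$-torsion, then $k=1$. (ii) If they are concordant due to $3$- or $6$-torsion, then $k=1$ or $k=3$.
   Context: For nonzero integers $m\neq n$, the forms $X^2+mY^2$ and $X^2+nY^2$ are concordant if the system $X^2+mY^2=Z^2$, $X^2+nY^2=W^2$ has an integer solution with $Y\neq0$. Let $Q(m,n)\subset\mathbb{P}^3$ be the curve $X_0^2+mX_1^2=X_2^2,\ X_0^2+nX_1^2=X_3^2$ and $E(m,n)$ the elliptic curve $y^2=x(x+m)(x+n)$ (projectively $Y^2T=X(X+mT)(X+nT)$, coordinates $(T:X:Y)$). There is an isomorphism of curves $\varphi:Q(m,n)\to E(m,n)$ extending the rational map $(X_0:X_1:X_2:X_3)\mapsto\bigl(nX_2-mX_3+(m-n)X_0 : mn(X_3-X_2) : mn(m-n)X_1\bigr)$; it maps the trivial points $(1:0:\pm1:\pm1)$ to the neutral element and the 2-torsion points, and every nontrivial rational solution to a rational point of order $>2$. The forms are said to be concordant due to $N$-torsion if some nontrivial rational solution $(X_0:X_1:X_2:X_3)$ (i.e. with $X_1\neq0$) is mapped by $\varphi$ to a rational point of $E(m,n)$ of order exactly $N$; equivalently, $E(m,n)(\mathbb{Q})$ has a point of order $N$. -}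

module Defs where

open import Algebra.Bundles.Raw using (RawMonoid)
import Algebra.Definitions.RawMonoid as RawMonoidDefs
open import Data.Integer.Base as ℤ using (ℤ)
open import Data.Nat.Base as ℕ using (ℕ)
open import Data.Nat.Divisibility using (_∣_)
open import Data.Product.Base using (_×_; _,_; Σ-syntax)
open import Data.Rational.Base using (ℚ; 0ℚ; 1ℚ; _+_; _*_; _-_; -_; _÷_; 1/_; _/_; ≢-nonZero)
open import Data.Rational.Properties using (_≟_; *-inverseʳ; *-zeroˡ; *-zeroʳ; *-identityʳ; +-identityʳ; +-inverseʳ)
open import Data.Rational.Solver using (module +-*-Solver)
open import Level using (0ℓ)
open import Relation.Binary.PropositionalEquality using (_≡_; _≢_; refl; sym; trans; cong; cong₂; module ≡-Reasoning)
open import Relation.Nullary.Decidable using (yes; no)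
open import Relation.Nullary.Negation using (¬_)

open +-*-Solver using (solve; _:=_; _:+_; _:*_; _:-_; :-_)

Squarefree : ℕ → Set
Squarefree k = ∀ d → (d ℕ.* d) ∣ k → d ≡ 1

private
  ÷-cancel : ∀ p q (q≢0 : q ≢ 0ℚ) → _÷_ p q {{≢-nonZero q≢0}} * q ≡ p
  ÷-cancel p q q≢0 = begin
    p * i * q    ≡⟨ solve 3 (λ p i q → p :* i :* q := p :* (q :* i)) refl p i q ⟩
    p * (q * i)  ≡⟨ cong (p *_) (*-inverseʳ q {{≢-nonZero q≢0}}) ⟩
    p * 1ℚ       ≡⟨ *-identityʳ p ⟩
    p            ∎
    where
    open ≡-Reasoning
    i = 1/_ q {{≢-nonZero q≢0}}

  *-cancel-0 : ∀ p q → q ≢ 0ℚ → p * q ≡ 0ℚ → p ≡ 0ℚ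
  *-cancel-0 p q q≢0 pq≡0 = begin
    p            ≡⟨ sym (÷-cancel p q q≢0) ⟩
    p * i * q    ≡⟨ solve 3 (λ p i q → p :* i :* q := p :* q :* i) refl p i q ⟩
    p * q * i    ≡⟨ cong (_* i) pq≡0 ⟩
    0ℚ * i       ≡⟨ *-zeroˡ i ⟩
    0ℚ           ∎
    where
    open ≡-Reasoning
    i = 1/_ q {{≢-nonZero q≢0}}

  -≡0 : ∀ {p q} → p ≡ q → p - q ≡ 0ℚ
  -≡0 {p} refl = +-inverseʳ p

  -≡0⁻¹ : ∀ {p q} → p - q ≡ 0ℚ → p ≡ q
  -≡0⁻¹ {p} {q} eq = begin
    p            ≡⟨ solve 2 (λ p q → p := q :+ (p :- q)) refl p q ⟩
    q + (p - q)  ≡⟨ cong (q +_) eq ⟩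
    q + 0ℚ       ≡⟨ +-identityʳ q ⟩
    q            ∎
    where open ≡-Reasoning

module Curves (m n : ℚ) where

  cubic : ℚ → ℚ
  cubic x = x * (x + m) * (x + n)

  cubic′ : ℚ → ℚ
  cubic′ x = (x + m) * (x + n) + x * (x + n) + x * (x + m)

  -- The rational points of E(m,n).  The only point with T = 0 is (0:0:1),
  -- here O; every other point is (1:x:y).
  data E : Set where
    O   : E
    aff : (x y : ℚ) → .(y * y ≡ cubic x) → E

  -- The third intersection point of E with the line of slope s through
  -- (x₁ , y₁) and (x₂ , y₂) is (thirdX , - thirdY).
  thirdX : (s x₁ x₂ : ℚ) → ℚ
  thirdX s x₁ x₂ = s * s - (m + n) - x₁ - x₂

  thirdY : (s x₁ y₁ x₂ : ℚ) → ℚ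
  thirdY s x₁ y₁ x₂ = - (y₁ + s * (thirdX s x₁ x₂ - x₁))

  private
    -- (cubic x - (y₁ + s (x - x₁))²) / (x - x₁), for (x₁ , y₁) on the curve.
    residual : (s x₁ y₁ x : ℚ) → ℚ
    residual s x₁ y₁ x =
      x * x + x * x₁ + x₁ * x₁ + (m + n) * (x + x₁) + m * n - s * (y₁ + y₁ + s * (x - x₁))

    third-on : ∀ s x₁ y₁ x₂ → y₁ * y₁ ≡ cubic x₁ → residual s x₁ y₁ x₂ ≡ 0ℚ →
               thirdY s x₁ y₁ x₂ * thirdY s x₁ y₁ x₂ ≡ cubic (thirdX s x₁ x₂)
    third-on s x₁ y₁ x₂ on res = begin
      thirdY s x₁ y₁ x₂ * thirdY s x₁ y₁ x₂
        ≡⟨ expand s x₁ y₁ x₂ x₃ ⟩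
      cubic x₃ + ((y₁ * y₁ - cubic x₁) - (x₃ - x₁) * (residual s x₁ y₁ x₂ + (x₃ - x₂) * (x₃ - thirdX s x₁ x₂)))
        ≡⟨ cong₂ (λ u v → cubic x₃ + (u - (x₃ - x₁) * v)) (-≡0 on)
             (cong₂ (λ u v → u + (x₃ - x₂) * v) res (+-inverseʳ x₃)) ⟩
      cubic x₃ + (0ℚ - (x₃ - x₁) * (0ℚ + (x₃ - x₂) * 0ℚ))
        ≡⟨ cong (λ u → cubic x₃ + (0ℚ - (x₃ - x₁) * (0ℚ + u))) (*-zeroʳ (x₃ - x₂)) ⟩
      cubic x₃ + (0ℚ - (x₃ - x₁) * 0ℚ)
        ≡⟨ cong (λ u → cubic x₃ + (0ℚ - u)) (*-zeroʳ (x₃ - x₁)) ⟩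
      cubic x₃ + 0ℚ
        ≡⟨ +-identityʳ (cubic x₃) ⟩
      cubic x₃ ∎
      where
      open ≡-Reasoning
      x₃ = thirdX s x₁ x₂
      expand : ∀ s x₁ y₁ x₂ x → (- (y₁ + s * (x - x₁))) * (- (y₁ + s * (x - x₁))) ≡
        cubic x + ((y₁ * y₁ - cubic x₁) - (x - x₁) * (residual s x₁ y₁ x₂ + (x - x₂) * (x - thirdX s x₁ x₂)))
      expand s x₁ y₁ x₂ x = solve 7 (λ m n s x₁ y₁ x₂ x →
        (:- (y₁ :+ s :* (x :- x₁))) :* (:- (y₁ :+ s :* (x :- x₁))) :=
        x :* (x :+ m) :* (x :+ n) :+ ((y₁ :* y₁ :- x₁ :* (x₁ :+ m) :* (x₁ :+ n))
          :- (x :- x₁) :* ((x₂ :* x₂ :+ x₂ :* x₁ :+ x₁ :* x₁ :+ (m :+ n) :* (x₂ :+ x₁) :+ m :* n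
                             :- s :* (y₁ :+ y₁ :+ s :* (x₂ :- x₁)))
                           :+ (x :- x₂) :* (x :- (s :* s :- (m :+ n) :- x₁ :- x₂)))))
        refl m n s x₁ y₁ x₂ x

    chord-residual : ∀ s x₁ y₁ x₂ y₂ → y₁ * y₁ ≡ cubic x₁ → y₂ * y₂ ≡ cubic x₂ →
                     x₂ - x₁ ≢ 0ℚ → s * (x₂ - x₁) ≡ y₂ - y₁ → residual s x₁ y₁ x₂ ≡ 0ℚ
    chord-residual s x₁ y₁ x₂ y₂ on₁ on₂ d≢0 slope = *-cancel-0 _ (x₂ - x₁) d≢0 (begin
      residual s x₁ y₁ x₂ * (x₂ - x₁)
        ≡⟨ solve 6 (λ m n s x₁ y₁ x₂ →
             (x₂ :* x₂ :+ x₂ :* x₁ :+ x₁ :* x₁ :+ (m :+ n) :* (x₂ :+ x₁) :+ m :* n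
               :- s :* (y₁ :+ y₁ :+ s :* (x₂ :- x₁))) :* (x₂ :- x₁) :=
             (x₂ :* (x₂ :+ m) :* (x₂ :+ n) :- x₁ :* (x₁ :+ m) :* (x₁ :+ n))
               :- (s :* (x₂ :- x₁)) :* (y₁ :+ y₁ :+ s :* (x₂ :- x₁)))
             refl m n s x₁ y₁ x₂ ⟩
      (cubic x₂ - cubic x₁) - (s * (x₂ - x₁)) * (y₁ + y₁ + s * (x₂ - x₁))
        ≡⟨ cong₂ (λ u v → u - v * (y₁ + y₁ + v)) (cong₂ _-_ (sym on₂) (sym on₁)) slope ⟩
      (y₂ * y₂ - y₁ * y₁) - (y₂ - y₁) * (y₁ + y₁ + (y₂ - y₁))
        ≡⟨ solve 2 (λ y₁ y₂ → (y₂ :* y₂ :- y₁ :* y₁) :- (y₂ :- y₁) :* (y₁ :+ y₁ :+ (y₂ :- y₁))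
             := y₁ :- y₁) refl y₁ y₂ ⟩
      y₁ - y₁
        ≡⟨ +-inverseʳ y₁ ⟩
      0ℚ ∎)
      where open ≡-Reasoning

    tangent-residual : ∀ s x₁ y₁ y₂ → y₁ * y₁ ≡ cubic x₁ → y₂ * y₂ ≡ cubic x₁ →
                       y₁ + y₂ ≢ 0ℚ → s * (y₁ + y₂) ≡ cubic′ x₁ → residual s x₁ y₁ x₁ ≡ 0ℚ
    tangent-residual s x₁ y₁ y₂ on₁ on₂ d≢0 slope = begin
      residual s x₁ y₁ x₁
        ≡⟨ solve 6 (λ m n s x₁ y₁ y₂ →
             x₁ :* x₁ :+ x₁ :* x₁ :+ x₁ :* x₁ :+ (m :+ n) :* (x₁ :+ x₁) :+ m :* n
               :- s :* (y₁ :+ y₁ :+ s :* (x₁ :- x₁)) :=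
             ((x₁ :+ m) :* (x₁ :+ n) :+ x₁ :* (x₁ :+ n) :+ x₁ :* (x₁ :+ m) :- s :* (y₁ :+ y₂))
               :- s :* (y₁ :- y₂))
             refl m n s x₁ y₁ y₂ ⟩
      (cubic′ x₁ - s * (y₁ + y₂)) - s * (y₁ - y₂)
        ≡⟨ cong₂ (λ u v → u - s * v) (-≡0 (sym slope)) y₁-y₂≡0 ⟩
      0ℚ - s * 0ℚ
        ≡⟨ cong (λ u → 0ℚ - u) (*-zeroʳ s) ⟩
      0ℚ ∎
      where
      open ≡-Reasoning
      y₁-y₂≡0 : y₁ - y₂ ≡ 0ℚ
      y₁-y₂≡0 = *-cancel-0 _ (y₁ + y₂) d≢0 (trans
        (solve 2 (λ y₁ y₂ → (y₁ :- y₂) :* (y₁ :+ y₂) := y₁ :* y₁ :- y₂ :* y₂) refl y₁ y₂)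
        (-≡0 (trans on₁ (sym on₂))))

  infixl 6 _⊕_

  -- Chord and tangent.  In the last case x₁ ≡ x₂ and y₁ ≢ - y₂, so that
  -- y₁ ≡ y₂ and the denominator y₁ + y₂ is 2y₁.
  _⊕_ : E → E → E
  O ⊕ Q = Q
  P@(aff _ _ _) ⊕ O = P
  aff x₁ y₁ on₁ ⊕ aff x₂ y₂ on₂ with x₁ ≟ x₂ | y₁ + y₂ ≟ 0ℚ
  ... | no x₁≢x₂ | _ = aff (thirdX s x₁ x₂) (thirdY s x₁ y₁ x₂)
          (third-on s x₁ y₁ x₂ on₁ (chord-residual s x₁ y₁ x₂ y₂ on₁ on₂ d≢0 (÷-cancel _ _ d≢0)))
    where
    d≢0 : x₂ - x₁ ≢ 0ℚ
    d≢0 eq = x₁≢x₂ (sym (-≡0⁻¹ eq))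
    s = _÷_ (y₂ - y₁) (x₂ - x₁) {{≢-nonZero d≢0}}
  ... | yes _ | yes _ = O
  ... | yes x₁≡x₂ | no d≢0 = aff (thirdX s x₁ x₁) (thirdY s x₁ y₁ x₁)
          (third-on s x₁ y₁ x₁ on₁ (tangent-residual s x₁ y₁ y₂ on₁
            (trans on₂ (cong cubic (sym x₁≡x₂))) d≢0 (÷-cancel _ _ d≢0)))
    where
    s = _÷_ (cubic′ x₁) (y₁ + y₂) {{≢-nonZero d≢0}}

  E-rawMonoid : RawMonoid 0ℓ 0ℓ
  E-rawMonoid = record { Carrier = E ; _≈_ = _≡_ ; _∙_ = _⊕_ ; ε = O }

  open RawMonoidDefs E-rawMonoid public using () renaming (_×_ to _•_)

  HasOrder : ℕ → E → Set
  HasOrder N P = (0 ℕ.< N) × (N • P ≡ O) × (∀ j → 0 ℕ.< j → j ℕ.< N → j • P ≢ O)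

  -- Homogeneous coordinates of a rational point of Q(m,n) ⊂ ℙ³.
  record Q : Set where
    field
      X₀ X₁ X₂ X₃ : ℚ
      nonzero : ¬ (X₀ ≡ 0ℚ × X₁ ≡ 0ℚ × X₂ ≡ 0ℚ × X₃ ≡ 0ℚ)
      eq₁ : X₀ * X₀ + m * (X₁ * X₁) ≡ X₂ * X₂
      eq₂ : X₀ * X₀ + n * (X₁ * X₁) ≡ X₃ * X₃

  Nontrivial : Q → Set
  Nontrivial P = Q.X₁ P ≢ 0ℚ

  module _ (P : Q) where
    open Q P

    φT φX φY : ℚ
    φT = n * X₂ - m * X₃ + (m - n) * X₀
    φX = m * n * (X₃ - X₂)
    φY = m * n * (m - n) * X₁

  private
    φ-homogeneous : ∀ P → φY P * φY P * φT P ≡ φX P * (φX P + m * φT P) * (φX P + n * φT P)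
    φ-homogeneous P = begin
      φY P * φY P * φT P
        ≡⟨ solve 6 (λ m n a b c d →
             let t = n :* c :- m :* d :+ (m :- n) :* a
                 y = m :* n :* (m :- n) :* b
                 w = m :* n :* (m :- n)
             in y :* y :* t := w :* w :* ((b :* b) :* t)) refl m n X₀ X₁ X₂ X₃ ⟩
      w * w * (X₁ * X₁ * φT P)
        ≡⟨ cong (w * w *_) (solve 6 (λ m n a b c d →
             b :* b :* (n :* c :- m :* d :+ (m :- n) :* a) :=
             (d :- a) :* (c :- a) :* (d :- c) :+ ((c :- a) :* (a :* a :+ n :* (b :* b) :- d :* d)
               :- (d :- a) :* (a :* a :+ m :* (b :* b) :- c :* c))) refl m n X₀ X₁ X₂ X₃) ⟩
      w * w * (r + ((X₂ - X₀) * (X₀ * X₀ + n * (X₁ * X₁) - X₃ * X₃)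
                    - (X₃ - X₀) * (X₀ * X₀ + m * (X₁ * X₁) - X₂ * X₂)))
        ≡⟨ cong₂ (λ u v → w * w * (r + ((X₂ - X₀) * u - (X₃ - X₀) * v))) (-≡0 eq₂) (-≡0 eq₁) ⟩
      w * w * (r + ((X₂ - X₀) * 0ℚ - (X₃ - X₀) * 0ℚ))
        ≡⟨ cong₂ (λ u v → w * w * (r + (u - v))) (*-zeroʳ (X₂ - X₀)) (*-zeroʳ (X₃ - X₀)) ⟩
      w * w * (r + 0ℚ)
        ≡⟨ cong (w * w *_) (+-identityʳ r) ⟩
      w * w * r
        ≡⟨ solve 5 (λ m n a c d →
             let w = m :* n :* (m :- n)
             in w :* w :* ((d :- a) :* (c :- a) :* (d :- c)) :=
                (m :* n :* (d :- c)) :* (m :* (m :- n) :* (a :- d)) :* (n :* (m :- n) :* (a :- c)))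
             refl m n X₀ X₂ X₃ ⟩
      φX P * (m * (m - n) * (X₀ - X₃)) * (n * (m - n) * (X₀ - X₂))
        ≡⟨ cong₂ (λ u v → φX P * u * v)
             (solve 5 (λ m n a c d → m :* (m :- n) :* (a :- d) :=
               m :* n :* (d :- c) :+ m :* (n :* c :- m :* d :+ (m :- n) :* a)) refl m n X₀ X₂ X₃)
             (solve 5 (λ m n a c d → n :* (m :- n) :* (a :- c) :=
               m :* n :* (d :- c) :+ n :* (n :* c :- m :* d :+ (m :- n) :* a)) refl m n X₀ X₂ X₃) ⟩
      φX P * (φX P + m * φT P) * (φX P + n * φT P) ∎
      where
      open ≡-Reasoning
      open Q P
      w = m * n * (m - n)
      r = (X₃ - X₀) * (X₂ - X₀) * (X₃ - X₂)

    dehomogenise : ∀ T X Y (T≢0 : T ≢ 0ℚ) → Y * Y * T ≡ X * (X + m * T) * (X + n * T) →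
      let instance _ = ≢-nonZero T≢0 in (Y ÷ T) * (Y ÷ T) ≡ cubic (X ÷ T)
    dehomogenise T X Y T≢0 eq = begin
      (Y * i) * (Y * i)
        ≡⟨ sym (*-identityʳ _) ⟩
      (Y * i) * (Y * i) * 1ℚ
        ≡⟨ cong ((Y * i) * (Y * i) *_) (sym Ti≡1) ⟩
      (Y * i) * (Y * i) * (T * i)
        ≡⟨ solve 3 (λ Y T i → (Y :* i) :* (Y :* i) :* (T :* i) := Y :* Y :* T :* (i :* i :* i)) refl Y T i ⟩
      Y * Y * T * (i * i * i)
        ≡⟨ cong (_* (i * i * i)) eq ⟩
      X * (X + m * T) * (X + n * T) * (i * i * i)
        ≡⟨ solve 5 (λ m n X T i → X :* (X :+ m :* T) :* (X :+ n :* T) :* (i :* i :* i) :=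
             (X :* i) :* (X :* i :+ m :* (T :* i)) :* (X :* i :+ n :* (T :* i))) refl m n X T i ⟩
      (X * i) * (X * i + m * (T * i)) * (X * i + n * (T * i))
        ≡⟨ cong (λ u → (X * i) * (X * i + m * u) * (X * i + n * u)) Ti≡1 ⟩
      (X * i) * (X * i + m * 1ℚ) * (X * i + n * 1ℚ)
        ≡⟨ cong₂ (λ u v → (X * i) * (X * i + u) * (X * i + v)) (*-identityʳ m) (*-identityʳ n) ⟩
      cubic (X * i) ∎
      where
      open ≡-Reasoning
      i = 1/_ T {{≢-nonZero T≢0}}
      Ti≡1 : T * i ≡ 1ℚ
      Ti≡1 = *-inverseʳ T {{≢-nonZero T≢0}}

  -- (φT : φX : φY) read in E.  When mn(m - n) ≢ 0, φT vanishes on Q(m,n) only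
  -- at (1:0:1:1), where all three coordinates vanish and the isomorphism takes
  -- the value O; so this is the extended map at every rational point.
  φ : Q → E
  φ P with φT P ≟ 0ℚ
  ... | yes _ = O
  ... | no T≢0 = aff (_÷_ (φX P) (φT P) {{≢-nonZero T≢0}}) (_÷_ (φY P) (φT P) {{≢-nonZero T≢0}})
                     (dehomogenise (φT P) (φX P) (φY P) T≢0 (φ-homogeneous P))

-- Meaningful for nonzero m ≢ n, where E(m,n) is nonsingular.
ConcordantDueToTorsion : (N : ℕ) (m n : ℤ) → Set
ConcordantDueToTorsion N m n = Σ[ P ∈ Q ] (Nontrivial P × HasOrder N (φ P))
  where open Curves (m / 1) (n / 1)

{-# OPTIONS --safe #-}
module Submission where

-- Only the x-coordinates of 2P and 4P matter.  If (x , y) doubles to x′, then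
-- x′, x′ + m and x′ + n are squares α², β², γ² of explicit rationals.  If P has
-- order 4 or 8, then P or 2P doubles to a point of order 2; as m < 0 < n this is
-- (-m , 0), so pk and (p + q)k are squares, l²a² and l²b² with a, b coprime.
-- If P has order 3 or 6, then P or 2P doubles to its own x-coordinate, which
-- forces αβ + αγ + βγ = 0, so that pk = l²a³(a + 2b) and qk = l²(a + b)³(b - a)
-- with a, b coprime.  As k is squarefree and p, q (or p, p + q) are coprime, the
-- numerator of l is ± 1, and k divides both cofactors of l², whose gcd divides
-- 1 or 3 respectively.
--
-- Associativity of the group law is avoided: collinearity of three points is a
-- symmetric relation, so P ⊕ X = ⊖ Y implies P ⊕ Y = ⊖ X, and this turns
-- N • P = O into i • P = ⊖ (j • P) for i + j = N.

open import Defs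
open import Data.Integer.Base as ℤ using (ℤ; +_)
import Data.Integer.Divisibility.Signed as ℤ
import Data.Integer.Properties as ℤ
import Data.Integer.Tactic.RingSolver as ℤ
open import Data.List.Base using ([]; _∷_)
open import Data.Nat as ℕ using (ℕ; zero; suc; s≤s; z≤n)
open import Data.Nat.Coprimality as Coprimality using (Coprime; coprime-divisor; coprime-factors)
open import Data.Nat.Divisibility using (_∣_; _∣?_; ∣-refl; ∣-trans; m∣m*n; n∣m*n; ∣1⇒≡1; 0∣⇒≡0; ∣⇒≤)
import Data.Nat.Properties as ℕ
open import Data.Product.Base using (_×_; _,_; Σ-syntax; proj₁; proj₂)
open import Data.Rational.Base as ℚ using (ℚ; mkℚ; 0ℚ; 1ℚ; _+_; _*_; _-_; -_; _÷_; 1/_; _/_; ≢-nonZero; toℚᵘ; ↥_; ↧_; ↧ₙ_)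
open import Data.Rational.Properties as ℚ using (_≟_; +-inverseʳ; +-inverseˡ; +-identityʳ; +-identityˡ; *-zeroʳ; *-zeroˡ; *-inverseʳ; toℚᵘ-injective; toℚᵘ-fromℚᵘ; fromℚᵘ-injective; toℚᵘ-homo-+; toℚᵘ-homo-*)
open import Data.Rational.Unnormalised.Base as ℚᵘ using (mkℚᵘ; *≡*)
import Data.Rational.Unnormalised.Properties as ℚᵘ
open import Data.Sum.Base using (_⊎_; inj₁; inj₂)
open import Level using (0ℓ)
open import Relation.Binary.PropositionalEquality using (_≡_; _≢_; refl; sym; trans; cong; cong₂; subst; subst₂)
open import Relation.Nullary.Decidable using (dec⇒maybe; yes; no; recompute; from-no)
open import Relation.Nullary.Negation using (contradiction)
open import Algebra.Properties.Group ℚ.+-0-group using (x∙y⁻¹≈ε⇒x≈y; x≈y⇒x∙y⁻¹≈ε; inverseˡ-unique; ⁻¹-involutive)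
open import Tactic.RingSolver using (solve)
open import Tactic.RingSolver.Core.AlmostCommutativeRing using (AlmostCommutativeRing; fromCommutativeRing)

-- Polynomial certificates for equations between rationals

ring : AlmostCommutativeRing 0ℓ 0ℓ
ring = fromCommutativeRing ℚ.+-*-commutativeRing (λ x → dec⇒maybe (0ℚ ≟ x))

-- A certificate of ideal membership: the coefficient `c` is supplied by hand and the remaining
-- polynomial identity is left to the ring solver. `combine₂` and `combine₃` do the same with more
-- generators.
combine₁ : ∀ {x y l r} c → l ≡ r → x - y ≡ c * (l - r) → x ≡ y
combine₁ c l≡r eq = x∙y⁻¹≈ε⇒x≈y _ _ (trans eq (trans (cong (c *_) (x≈y⇒x∙y⁻¹≈ε l≡r)) (*-zeroʳ c)))

combine₂ : ∀ {x y l₁ r₁ l₂ r₂} c₁ c₂ → l₁ ≡ r₁ → l₂ ≡ r₂ →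
           x - y ≡ c₁ * (l₁ - r₁) + c₂ * (l₂ - r₂) → x ≡ y
combine₂ {r₂ = r₂} c₁ c₂ eq₁ refl eq = combine₁ c₁ eq₁ (trans eq (trans
  (cong (_+_ (c₁ * _)) (trans (cong (c₂ *_) (+-inverseʳ r₂)) (*-zeroʳ c₂))) (+-identityʳ _)))

combine₃ : ∀ {x y l₁ r₁ l₂ r₂ l₃ r₃} c₁ c₂ c₃ → l₁ ≡ r₁ → l₂ ≡ r₂ → l₃ ≡ r₃ →
           x - y ≡ c₁ * (l₁ - r₁) + c₂ * (l₂ - r₂) + c₃ * (l₃ - r₃) → x ≡ y
combine₃ {r₃ = r₃} c₁ c₂ c₃ eq₁ eq₂ refl eq = combine₂ c₁ c₂ eq₁ eq₂ (trans eq (trans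
  (cong (_+_ (c₁ * _ + c₂ * _)) (trans (cong (c₃ *_) (+-inverseʳ r₃)) (*-zeroʳ c₃))) (+-identityʳ _)))

y*i≡1⇒x*i*y≡x : ∀ x {y i} → y * i ≡ 1ℚ → x * i * y ≡ x
y*i≡1⇒x*i*y≡x x {y} {i} eq = combine₁ x eq (solve (x ∷ y ∷ i ∷ []) ring)

x÷y*y≡x : ∀ x y (y≢0 : y ≢ 0ℚ) → _÷_ x y {{≢-nonZero y≢0}} * y ≡ x
x÷y*y≡x x y y≢0 = y*i≡1⇒x*i*y≡x x (*-inverseʳ y {{≢-nonZero y≢0}})

x*z≡y*z⇒x≡y : ∀ {x y z} → z ≢ 0ℚ → x * z ≡ y * z → x ≡ y
x*z≡y*z⇒x≡y {x} {y} {z} z≢0 eq = cancel (1/_ z {{≢-nonZero z≢0}}) (*-inverseʳ z {{≢-nonZero z≢0}})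
  where
  -- The inverse becomes a variable with one relation, so that the solver faces polynomials only.
  cancel : ∀ i → z * i ≡ 1ℚ → x ≡ y
  cancel i zi≡1 = combine₂ (y - x) i zi≡1 eq (solve (x ∷ y ∷ z ∷ i ∷ []) ring)

x+x≡0⇒x≡0 : ∀ {x} → x + x ≡ 0ℚ → x ≡ 0ℚ
x+x≡0⇒x≡0 {x} eq = x*z≡y*z⇒x≡y {z = 1ℚ + 1ℚ} (λ ()) (combine₁ 1ℚ eq (solve (x ∷ []) ring))

-- Collinear points and the chord-tangent sum

module _ (m n : ℚ) where
  open Curves m n

  -- The three points are, with multiplicity, the intersection of the curve with
  -- the line: Σx and Σxx compare the coefficients of x² and x in
  -- cubic x - (slope * x + intercept)² = (x - x₁)(x - x₂)(x - x₃).
  record Line (x₁ y₁ x₂ y₂ x₃ y₃ : ℚ) : Set where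
    field
      slope intercept : ℚ
      on₁ : y₁ ≡ slope * x₁ + intercept
      on₂ : y₂ ≡ slope * x₂ + intercept
      on₃ : y₃ ≡ slope * x₃ + intercept
      Σx  : slope * slope ≡ m + n + x₁ + x₂ + x₃
      Σxx : slope * intercept + slope * intercept ≡ m * n - (x₁ * x₂ + x₁ * x₃ + x₂ * x₃)

  Line-swap : ∀ {x₁ y₁ x₂ y₂ x₃ y₃} → Line x₁ y₁ x₂ y₂ x₃ y₃ → Line x₁ y₁ x₃ y₃ x₂ y₂
  Line-swap {x₁} {_} {x₂} {_} {x₃} L = record
    { slope = s ; intercept = t ; on₁ = on₁ ; on₂ = on₃ ; on₃ = on₂
    ; Σx  = trans Σx (solve (m ∷ n ∷ x₁ ∷ x₂ ∷ x₃ ∷ []) ring)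
    ; Σxx = trans Σxx (solve (m ∷ n ∷ x₁ ∷ x₂ ∷ x₃ ∷ []) ring)
    }
    where open Line L renaming (slope to s; intercept to t)

  Line-chord : ∀ s {x₁ y₁ x₂ y₂ x₃ y₃} →
               y₁ * y₁ ≡ x₁ * (x₁ + m) * (x₁ + n) → y₂ * y₂ ≡ x₂ * (x₂ + m) * (x₂ + n) →
               x₂ - x₁ ≢ 0ℚ → s * (x₂ - x₁) ≡ y₂ - y₁ →
               x₃ ≡ s * s - (m + n) - x₁ - x₂ → y₃ ≡ - (y₁ + s * (x₃ - x₁)) →
               Line x₁ y₁ x₂ y₂ x₃ (- y₃)
  Line-chord s {x₁} {y₁} {x₂} {y₂} {x₃} {y₃} h₁ h₂ d≢0 hs hx hy = record
    { slope = s ; intercept = y₁ - s * x₁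
    ; on₁ = solve (s ∷ x₁ ∷ y₁ ∷ []) ring
    ; on₂ = combine₁ (- 1ℚ) hs (solve (s ∷ x₁ ∷ y₁ ∷ x₂ ∷ y₂ ∷ []) ring)
    ; on₃ = combine₁ (- 1ℚ) hy (solve (s ∷ x₁ ∷ y₁ ∷ x₃ ∷ y₃ ∷ []) ring)
    ; Σx  = combine₁ (- 1ℚ) hx (solve (m ∷ n ∷ s ∷ x₁ ∷ x₂ ∷ x₃ ∷ []) ring)
    -- After multiplication by `x₂ - x₁` and elimination of `x₃`, this is the difference of the two
    -- curve equations, with `y₂ - y₁` expressed through the slope.
    ; Σxx = x*z≡y*z⇒x≡y d≢0 (combine₂ 1ℚ ((x₁ + x₂) * (x₂ - x₁))
        (combine₃ {(s * s * (x₂ - x₁) + s * (y₁ + y₁)) * (x₂ - x₁)}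
                  {x₂ * (x₂ + m) * (x₂ + n) - x₁ * (x₁ + m) * (x₁ + n)}
          (- 1ℚ) 1ℚ (s * (x₂ - x₁) + y₁ + y₂) h₁ h₂ hs
          (solve (m ∷ n ∷ s ∷ x₁ ∷ y₁ ∷ x₂ ∷ y₂ ∷ []) ring))
        hx (solve (m ∷ n ∷ s ∷ x₁ ∷ y₁ ∷ x₂ ∷ x₃ ∷ []) ring))
    }

  Line-tangent : ∀ s {x y y′ x₃ y₃} → y′ ≡ y → s * (y + y′) ≡ (x + m) * (x + n) + x * (x + n) + x * (x + m) →
                 x₃ ≡ s * s - (m + n) - x - x → y₃ ≡ - (y + s * (x₃ - x)) →
                 Line x y x y′ x₃ (- y₃)
  Line-tangent s {x} {y} {_} {x₃} {y₃} refl hs hx hy = record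
    { slope = s ; intercept = y - s * x
    ; on₁ = solve (s ∷ x ∷ y ∷ []) ring
    ; on₂ = solve (s ∷ x ∷ y ∷ []) ring
    ; on₃ = combine₁ (- 1ℚ) hy (solve (s ∷ x ∷ y ∷ x₃ ∷ y₃ ∷ []) ring)
    ; Σx  = combine₁ (- 1ℚ) hx (solve (m ∷ n ∷ s ∷ x ∷ x₃ ∷ []) ring)
    ; Σxx = combine₂ 1ℚ (x + x) hs hx (solve (m ∷ n ∷ s ∷ x ∷ y ∷ x₃ ∷ []) ring)
    }

  chord-slope : ∀ {x₁ y₁ x₂ y₂ x₃ y₃} (L : Line x₁ y₁ x₂ y₂ x₃ y₃) → y₂ - y₁ ≡ Line.slope L * (x₂ - x₁)
  chord-slope {x₁} {y₁} {x₂} {y₂} record { slope = s ; intercept = t ; on₁ = on₁ ; on₂ = on₂ } =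
    combine₂ 1ℚ (- 1ℚ) on₂ on₁ (solve (s ∷ t ∷ x₁ ∷ y₁ ∷ x₂ ∷ y₂ ∷ []) ring)

  -- The cubic minus the square of the line has a double root at `x`, so its derivative vanishes
  -- there. The denominator is kept as `y + y′` because `_⊕_` divides by `y₁ + y₂`.
  tangent-slope : ∀ {x y y′ x₃ y₃} → y′ ≡ y → (L : Line x y x y′ x₃ y₃) →
                  Line.slope L * (y + y′) ≡ (x + m) * (x + n) + x * (x + n) + x * (x + m)
  tangent-slope {x} {y} {_} {x₃} refl record { slope = s ; intercept = t ; on₁ = on₁ ; Σx = Σx ; Σxx = Σxx } =
    combine₃ (s + s) (x + x) 1ℚ on₁ Σx Σxx (solve (m ∷ n ∷ s ∷ t ∷ x ∷ y ∷ x₃ ∷ []) ring)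

  aff-cong : ∀ {x y x′ y′} .{h : y * y ≡ cubic x} .{h′ : y′ * y′ ≡ cubic x′} →
             x ≡ x′ → y ≡ y′ → aff x y h ≡ aff x′ y′ h′
  aff-cong refl refl = refl

  aff-injective : ∀ {x y x′ y′} .{h : y * y ≡ cubic x} .{h′ : y′ * y′ ≡ cubic x′} →
                  aff x y h ≡ aff x′ y′ h′ → x ≡ x′ × y ≡ y′
  aff-injective refl = refl , refl

  y²-injective : ∀ {y₁ y₂ c} → y₁ * y₁ ≡ c → y₂ * y₂ ≡ c → y₁ + y₂ ≢ 0ℚ → y₂ ≡ y₁
  y²-injective {y₁} {y₂} {c} h₁ h₂ d≢0 = x*z≡y*z⇒x≡y d≢0
    (combine₂ (- 1ℚ) 1ℚ h₁ h₂ (solve (y₁ ∷ y₂ ∷ c ∷ []) ring))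

  -- The sum is the reflection of the third intersection point, whence the sign of `y₃`.
  ⊕-line : ∀ x₁ y₁ .h₁ x₂ y₂ .h₂ {x₃ y₃} .{h₃} → aff x₁ y₁ h₁ ⊕ aff x₂ y₂ h₂ ≡ aff x₃ y₃ h₃ →
           Line x₁ y₁ x₂ y₂ x₃ (- y₃)
  ⊕-line x₁ y₁ h₁ x₂ y₂ h₂ eq with x₁ ≟ x₂ | y₁ + y₂ ≟ 0ℚ
  ⊕-line x₁ y₁ h₁ x₂ y₂ h₂ refl | no x₁≢x₂ | _ =
    Line-chord (_÷_ (y₂ - y₁) (x₂ - x₁) {{≢-nonZero d≢0}}) (recompute (_ ≟ _) h₁) (recompute (_ ≟ _) h₂) d≢0
      (x÷y*y≡x (y₂ - y₁) (x₂ - x₁) d≢0) refl refl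
    where
    d≢0 : x₂ - x₁ ≢ 0ℚ
    d≢0 d≡0 = x₁≢x₂ (sym (x∙y⁻¹≈ε⇒x≈y _ _ d≡0))
  ⊕-line x₁ y₁ h₁ x₂ y₂ h₂ refl | yes refl | no d≢0 =
    Line-tangent (_÷_ (cubic′ x₁) (y₁ + y₂) {{≢-nonZero d≢0}})
      (y²-injective (recompute (y₁ * y₁ ≟ cubic x₁) h₁) (recompute (y₂ * y₂ ≟ cubic x₁) h₂) d≢0)
      (x÷y*y≡x (cubic′ x₁) (y₁ + y₂) d≢0) refl refl

  ⊕-vertical : ∀ x₁ y₁ .h₁ x₂ y₂ .h₂ → x₁ ≡ x₂ → y₁ + y₂ ≡ 0ℚ → aff x₁ y₁ h₁ ⊕ aff x₂ y₂ h₂ ≡ O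
  ⊕-vertical x₁ y₁ h₁ x₂ y₂ h₂ x₁≡x₂ y₁+y₂≡0 with x₁ ≟ x₂ | y₁ + y₂ ≟ 0ℚ
  ... | no x₁≢x₂ | _ = contradiction x₁≡x₂ x₁≢x₂
  ... | yes _ | yes _ = refl
  ... | yes _ | no d≢0 = contradiction y₁+y₂≡0 d≢0

  thirdPoint≡ : ∀ s {x₁ y₁ x₂ y₂ x₃ y₃} .{h h₃} (L : Line x₁ y₁ x₂ y₂ x₃ (- y₃)) → s ≡ Line.slope L →
                aff (thirdX s x₁ x₂) (thirdY s x₁ y₁ x₂) h ≡ aff x₃ y₃ h₃
  thirdPoint≡ s {x₁} {y₁} {x₂} {_} {x₃} {y₃}
    record { slope = .s ; intercept = t ; on₁ = on₁ ; on₃ = on₃ ; Σx = Σx } refl = aff-cong x≡ y≡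
    where
    x≡ : s * s - (m + n) - x₁ - x₂ ≡ x₃
    x≡ = combine₁ 1ℚ Σx (solve (m ∷ n ∷ s ∷ x₁ ∷ x₂ ∷ x₃ ∷ []) ring)
    y≡ : - (y₁ + s * (s * s - (m + n) - x₁ - x₂ - x₁)) ≡ y₃
    y≡ = trans (cong (λ x → - (y₁ + s * (x - x₁))) x≡)
      (combine₂ (- 1ℚ) 1ℚ on₁ on₃ (solve (s ∷ t ∷ x₁ ∷ y₁ ∷ x₃ ∷ y₃ ∷ []) ring))

  line-⊕ : ∀ x₁ y₁ .h₁ x₂ y₂ .h₂ {x₃ y₃} .{h₃} → Line x₁ y₁ x₂ y₂ x₃ (- y₃) →
           aff x₁ y₁ h₁ ⊕ aff x₂ y₂ h₂ ≢ O → aff x₁ y₁ h₁ ⊕ aff x₂ y₂ h₂ ≡ aff x₃ y₃ h₃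
  line-⊕ x₁ y₁ h₁ x₂ y₂ h₂ L sum≢O with x₁ ≟ x₂ | y₁ + y₂ ≟ 0ℚ
  ... | no x₁≢x₂ | _ = thirdPoint≡ (_÷_ (y₂ - y₁) (x₂ - x₁) {{≢-nonZero d≢0}}) L
    (x*z≡y*z⇒x≡y d≢0 (trans (x÷y*y≡x (y₂ - y₁) (x₂ - x₁) d≢0) (chord-slope L)))
    where
    d≢0 : x₂ - x₁ ≢ 0ℚ
    d≢0 d≡0 = x₁≢x₂ (sym (x∙y⁻¹≈ε⇒x≈y _ _ d≡0))
  -- Here the line would force `y₁ = y₂ = 0` and a vanishing derivative of the cubic, that is, a
  -- singular point. As `m` and `n` are arbitrary at this stage, the hypothesis on the sum excludes
  -- it.
  ... | yes _ | yes _ = contradiction refl sum≢O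
  ... | yes refl | no d≢0 =
    thirdPoint≡ (_÷_ (cubic′ x₁) (y₁ + y₂) {{≢-nonZero d≢0}}) L
      (x*z≡y*z⇒x≡y d≢0 (trans (x÷y*y≡x (cubic′ x₁) (y₁ + y₂) d≢0) (sym
        (tangent-slope (trans (Line.on₂ L) (sym (Line.on₁ L))) L))))

  -- Negation, and multiples of a point of finite order

  ⊖_ : E → E
  ⊖ O = O
  ⊖ aff x y h = aff x (- y) (trans (-y*-y≡y*y y) h)
    where
    -y*-y≡y*y : ∀ y → - y * - y ≡ y * y
    -y*-y≡y*y y = solve (y ∷ []) ring

  ⊖-involutive : ∀ P → ⊖ (⊖ P) ≡ P
  ⊖-involutive O = refl
  ⊖-involutive (aff x y h) = aff-cong refl (⁻¹-involutive y)

  ⊕≡O⇒vertical : ∀ x₁ y₁ .h₁ x₂ y₂ .h₂ → aff x₁ y₁ h₁ ⊕ aff x₂ y₂ h₂ ≡ O → x₁ ≡ x₂ × y₁ + y₂ ≡ 0ℚ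
  ⊕≡O⇒vertical x₁ y₁ h₁ x₂ y₂ h₂ eq with x₁ ≟ x₂ | y₁ + y₂ ≟ 0ℚ
  ⊕≡O⇒vertical x₁ y₁ h₁ x₂ y₂ h₂ () | no _ | _
  ⊕≡O⇒vertical x₁ y₁ h₁ x₂ y₂ h₂ () | yes _ | no _
  ⊕≡O⇒vertical x₁ y₁ h₁ x₂ y₂ h₂ eq | yes x₁≡x₂ | yes y₁+y₂≡0 = x₁≡x₂ , y₁+y₂≡0

  ⊕≡O⇒≡⊖ : ∀ P X → P ⊕ X ≡ O → P ≡ ⊖ X
  ⊕≡O⇒≡⊖ O .O refl = refl
  ⊕≡O⇒≡⊖ (aff x₁ y₁ h₁) (aff x₂ y₂ h₂) eq =
    let x₁≡x₂ , y₁+y₂≡0 = ⊕≡O⇒vertical x₁ y₁ h₁ x₂ y₂ h₂ eq in aff-cong x₁≡x₂ (inverseˡ-unique _ _ y₁+y₂≡0)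

  reflect : ∀ P X Y → P ≢ O → X ≢ O → Y ≢ O → P ⊕ Y ≢ O → P ⊕ X ≡ ⊖ Y → P ⊕ Y ≡ ⊖ X
  reflect O X Y P≢O _ _ _ _ = contradiction refl P≢O
  reflect P O Y _ X≢O _ _ _ = contradiction refl X≢O
  reflect P X O _ _ Y≢O _ _ = contradiction refl Y≢O
  reflect (aff x₁ y₁ h₁) (aff x₂ y₂ h₂) (aff x₃ y₃ h₃) _ _ _ sum≢O eq =
    line-⊕ x₁ y₁ h₁ x₃ y₃ h₃ (subst₂ (λ y y′ → Line x₁ y₁ x₃ y x₂ y′) (⁻¹-involutive y₃) (sym (⁻¹-involutive y₂))
      (Line-swap (⊕-line x₁ y₁ h₁ x₂ y₂ h₂ eq))) sum≢O

  -- Induction on `i`: `reflect` moves one copy of `P` from the right multiple to the left one, and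
  -- minimality of `N` keeps all multiples involved away from `O`.
  •-complement : ∀ {N P} → HasOrder N P → ∀ i j → 0 ℕ.< i → 0 ℕ.< j → i ℕ.+ j ≡ N → i • P ≡ ⊖ (j • P)
  •-complement {_} {O} (_ , _ , min) (suc i) (suc j) _ _ refl =
    contradiction refl (min 1 (s≤s z≤n) (s≤s (ℕ.≤-trans (s≤s z≤n) (ℕ.m≤n+m (suc j) i))))
  •-complement {_} {P@(aff _ _ _)} (_ , N•P≡O , _) 1 (suc j) _ _ refl = ⊕≡O⇒≡⊖ P (suc j • P) N•P≡O
  •-complement {_} {P@(aff _ _ _)} ord@(_ , N•P≡O , min) (suc (suc i)) (suc j) _ _ refl =
    reflect P (suc j • P) (suc i • P) (λ ())
      (min (suc j) (s≤s z≤n) (s≤s (ℕ.m≤n+m (suc j) (suc i))))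
      (min (suc i) (s≤s z≤n) (ℕ.m≤m+n (2 ℕ.+ i) (suc j)))
      (min (suc (suc i)) (s≤s z≤n) (ℕ.m<m+n (2 ℕ.+ i) (s≤s z≤n)))
      -- The induction hypothesis for `i + 1` and `j + 2`, solved for the multiple
      -- `P ⊕ (suc j • P)`.
      (trans (sym (⊖-involutive _)) (cong ⊖_ (sym
        (•-complement ord (suc i) (suc (suc j)) (s≤s z≤n) (s≤s z≤n) (ℕ.+-suc (suc i) (suc j))))))

  -- Doubling and quadrupling in terms of x-coordinates

  -- x′ is the x-coordinate of 2(x , y).
  record DoublesTo (x y x′ : ℚ) : Set where
    field
      on-curve : y * y ≡ x * (x + m) * (x + n)
      inv      : ℚ
      inverse  : (y + y) * inv ≡ 1ℚ
      formula  : ((x + m) * (x + n) + x * (x + n) + x * (x + m)) * inv *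
                 (((x + m) * (x + n) + x * (x + n) + x * (x + m)) * inv) ≡ m + n + x + x + x′

  -- The tangent slope may be any `v` with the right product by `2y`. It is traded for the inverse
  -- of `2y`, in which the later certificates are polynomial.
  doublesTo : ∀ v {x y x′} → y * y ≡ x * (x + m) * (x + n) → y + y ≢ 0ℚ →
              v * (y + y) ≡ (x + m) * (x + n) + x * (x + n) + x * (x + m) →
              v * v ≡ m + n + x + x + x′ → DoublesTo x y x′
  doublesTo v {x} {y} on d≢0 hv hx = record
    { on-curve = on ; inv = i ; inverse = inverse
    ; formula = trans (cong₂ _*_ (f*i≡v hv inverse) (f*i≡v hv inverse)) hx }
    where
    i = 1/_ (y + y) {{≢-nonZero d≢0}}
    inverse : (y + y) * i ≡ 1ℚ
    inverse = *-inverseʳ (y + y) {{≢-nonZero d≢0}}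
    f*i≡v : ∀ {z f i} → v * z ≡ f → z * i ≡ 1ℚ → f * i ≡ v
    f*i≡v {z} {f} {i} hv inverse = combine₂ (- i) v hv inverse (solve (v ∷ z ∷ f ∷ i ∷ []) ring)

  double : ∀ x y .h {x₂ y₂} .{h₂} → aff x y h ⊕ aff x y h ≡ aff x₂ y₂ h₂ → DoublesTo x y x₂
  double x y h eq = doublesTo (Line.slope L) (recompute (_ ≟ _) h)
    (λ y+y≡0 → contradiction (trans (sym eq) (⊕-vertical x y h x y h refl y+y≡0)) λ ())
    (tangent-slope refl L) (Line.Σx L)
    where L = ⊕-line x y h x y h eq

  -- If t, s, u are the slopes of the lines joining P to P, 2P, 3P, then the slope
  -- of the tangent at 2P is u + s - t.
  line-quadruple : ∀ {x₁ y₁ x₂ y₂ x₃ y₃ x₄ y₄} → Line x₁ y₁ x₁ y₁ x₂ (- y₂) → Line x₁ y₁ x₂ y₂ x₃ (- y₃) →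
    Line x₁ y₁ x₃ y₃ x₄ (- y₄) → y₂ * y₂ ≡ x₂ * (x₂ + m) * (x₂ + n) → x₂ ≢ x₁ → x₃ ≢ x₁ →
    DoublesTo x₂ y₂ x₄
  line-quadruple {x₁} {y₁} {x₂} {y₂} {x₃} {y₃} {x₄} L₁ L₂ L₃ on x₂≢x₁ x₃≢x₁ =
    from-slopes (Line.slope L₁) (Line.slope L₂) (Line.slope L₃)
      (chord-slope (Line-swap L₁)) (chord-slope L₂) (chord-slope (Line-swap L₂)) (chord-slope L₃)
      (Line.Σx L₁) (Line.Σx L₂) (Line.Σx L₃) (tangent-slope refl L₁)
    where
    from-slopes : ∀ t s u →
      - y₂ - y₁ ≡ t * (x₂ - x₁) → y₂ - y₁ ≡ s * (x₂ - x₁) →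
      - y₃ - y₁ ≡ s * (x₃ - x₁) → y₃ - y₁ ≡ u * (x₃ - x₁) →
      t * t ≡ m + n + x₁ + x₁ + x₂ → s * s ≡ m + n + x₁ + x₂ + x₃ → u * u ≡ m + n + x₁ + x₃ + x₄ →
      t * (y₁ + y₁) ≡ (x₁ + m) * (x₁ + n) + x₁ * (x₁ + n) + x₁ * (x₁ + m) →
      DoublesTo x₂ y₂ x₄
    from-slopes t s u t₂ s₂ s₃ u₃ T S U tan =
      doublesTo (u + s - t) on 2y₂≢0 (trans v*2y₂ (sym f′[x₂])) v*v
      where
      -- `s` and `t` are the slopes from `P` to `2P` and to its reflection, so their sum eliminates
      -- `y₂`. In the same way `s + u` eliminates `y₃`.
      [s+t][x₂-x₁] : (s + t) * (x₂ - x₁) ≡ - (y₁ + y₁)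
      [s+t][x₂-x₁] = combine₂ (- 1ℚ) (- 1ℚ) t₂ s₂ (solve (s ∷ t ∷ x₁ ∷ x₂ ∷ y₁ ∷ y₂ ∷ []) ring)
      [s+u][x₃-x₁] : (s + u) * (x₃ - x₁) ≡ - (y₁ + y₁)
      [s+u][x₃-x₁] = combine₂ (- 1ℚ) (- 1ℚ) s₃ u₃ (solve (s ∷ u ∷ x₁ ∷ x₃ ∷ y₁ ∷ y₃ ∷ []) ring)
      [s-t][s+t] : (s - t) * (s + t) ≡ x₃ - x₁
      [s-t][s+t] = combine₂ 1ℚ (- 1ℚ) S T (solve (m ∷ n ∷ s ∷ t ∷ x₁ ∷ x₂ ∷ x₃ ∷ []) ring)
      s+t≢0 : s + t ≢ 0ℚ
      s+t≢0 eq = x₃≢x₁ (x∙y⁻¹≈ε⇒x≈y _ _ (trans (sym [s-t][s+t]) (trans (cong ((s - t) *_) eq) (*-zeroʳ (s - t)))))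
      s-t≢0 : s - t ≢ 0ℚ
      s-t≢0 eq = x₃≢x₁ (x∙y⁻¹≈ε⇒x≈y _ _ (trans (sym [s-t][s+t]) (trans (cong (_* (s + t)) eq) (*-zeroˡ (s + t)))))
      -- Both sides become `- 2y₁` after multiplication by `s + t`.
      [s+u][s-t] : (s + u) * (s - t) ≡ x₂ - x₁
      [s+u][s-t] = x*z≡y*z⇒x≡y s+t≢0
        (combine₃ (s + u) 1ℚ (- 1ℚ) [s-t][s+t] [s+u][x₃-x₁] [s+t][x₂-x₁]
          (solve (s ∷ t ∷ u ∷ x₁ ∷ x₂ ∷ x₃ ∷ y₁ ∷ []) ring))
      2y₂ : y₂ + y₂ ≡ (s - t) * (x₂ - x₁)
      2y₂ = combine₂ 1ℚ (- 1ℚ) s₂ t₂ (solve (s ∷ t ∷ x₁ ∷ x₂ ∷ y₁ ∷ y₂ ∷ []) ring)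
      2y₂≢0 : y₂ + y₂ ≢ 0ℚ
      2y₂≢0 eq = s-t≢0 (x*z≡y*z⇒x≡y (λ x₂-x₁≡0 → x₂≢x₁ (x∙y⁻¹≈ε⇒x≈y _ _ x₂-x₁≡0))
        (trans (sym 2y₂) (trans eq (sym (*-zeroˡ (x₂ - x₁))))))
      f′[x₂] : (x₂ + m) * (x₂ + n) + x₂ * (x₂ + n) + x₂ * (x₂ + m) ≡
               (x₂ - x₁) * (x₂ - x₁ + t * t - t * s)
      f′[x₂] = combine₃ (- 1ℚ) t (- (x₂ - x₁ + (x₂ - x₁))) tan [s+t][x₂-x₁] T
        (solve (m ∷ n ∷ s ∷ t ∷ x₁ ∷ x₂ ∷ y₁ ∷ []) ring)
      v*2y₂ : (u + s - t) * (y₂ + y₂) ≡ (x₂ - x₁) * (x₂ - x₁ + t * t - t * s)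
      v*2y₂ = combine₂ (u + s - t) (x₂ - x₁) 2y₂ [s+u][s-t] (solve (s ∷ t ∷ u ∷ x₁ ∷ x₂ ∷ y₂ ∷ []) ring)
      v*v : (u + s - t) * (u + s - t) ≡ m + n + x₂ + x₂ + x₄
      v*v = combine₃ 1ℚ (1ℚ + 1ℚ) (- 1ℚ) U [s+u][s-t] [s-t][s+t]
        (solve (m ∷ n ∷ s ∷ t ∷ u ∷ x₁ ∷ x₂ ∷ x₃ ∷ x₄ ∷ []) ring)

  -- For a root `r` of the cubic with other roots `r′`, `r″`, the duplication formula makes `x′ - r`
  -- the square of `((x - r)² - (r - r′)(r - r″)) / 2y`. With these signs `α + β = x(x + m)/y` and
  -- `α + γ = x(x + n)/y`, whose product is `x` by the curve equation.
  halving-squares : ∀ {x y x′} → DoublesTo x y x′ → Σ[ α ∈ ℚ ] Σ[ β ∈ ℚ ] Σ[ γ ∈ ℚ ]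
    (α * α ≡ x′) × (β * β ≡ x′ + m) × (γ * γ ≡ x′ + n) × ((α + β) * (α + γ) ≡ x)
  halving-squares {x} {y} {x′} record { on-curve = on ; inv = i ; inverse = inverse ; formula = formula } =
      (x * x - m * n) * i , (x * x + (m + m) * x + m * n) * i , (x * x + (n + n) * x + m * n) * i
    , combine₃ 1ℚ (- (m + n + x + x) * ((y + y) * i + 1ℚ)) ((m + n + x + x) * (i + i) * (i + i)) formula inverse on
        (solve (m ∷ n ∷ x ∷ y ∷ x′ ∷ i ∷ []) ring)
    , combine₃ 1ℚ (- (n + x + x) * ((y + y) * i + 1ℚ)) ((n + x + x) * (i + i) * (i + i)) formula inverse on
        (solve (m ∷ n ∷ x ∷ y ∷ x′ ∷ i ∷ []) ring)
    , combine₃ 1ℚ (- (m + x + x) * ((y + y) * i + 1ℚ)) ((m + x + x) * (i + i) * (i + i)) formula inverse on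
        (solve (m ∷ n ∷ x ∷ y ∷ x′ ∷ i ∷ []) ring)
    , combine₂ (x * ((y + y) * i + 1ℚ)) (- x * (i + i) * (i + i)) inverse on
        (solve (m ∷ n ∷ x ∷ y ∷ i ∷ []) ring)

  -- From points of given order to doublings

  affine : ∀ P → P ≢ O → Σ[ x ∈ ℚ ] Σ[ y ∈ ℚ ] Σ[ h ∈ y * y ≡ cubic x ] P ≡ aff x y h
  affine O P≢O = contradiction refl P≢O
  affine (aff x y h) _ = x , y , recompute (_ ≟ _) h , refl

  -- The first point and the reflection of the sum lie on one line that has a slope, so with equal
  -- x-coordinates they coincide. In `quadruple` this keeps `2P` and `3P` off the vertical line
  -- through `P`.
  ⊕-collision : ∀ x₁ y₁ .h₁ x₂ y₂ .h₂ {x₃ y₃} .{h₃} → aff x₁ y₁ h₁ ⊕ aff x₂ y₂ h₂ ≡ aff x₃ y₃ h₃ →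
                x₃ ≡ x₁ → aff x₁ y₁ h₁ ⊕ aff x₃ y₃ h₃ ≡ O
  ⊕-collision x₁ y₁ h₁ x₂ y₂ h₂ {x₃} {y₃} {h₃} eq x₃≡x₁ =
    ⊕-vertical x₁ y₁ h₁ x₃ y₃ h₃ (sym x₃≡x₁) (trans (cong (_+ y₃) y₁≡-y₃) (+-inverseˡ y₃))
    where
    L = ⊕-line x₁ y₁ h₁ x₂ y₂ h₂ eq
    y₁≡-y₃ : y₁ ≡ - y₃
    y₁≡-y₃ = trans (Line.on₁ L)
      (trans (cong (λ x → Line.slope L * x + Line.intercept L) (sym x₃≡x₁)) (sym (Line.on₃ L)))

  1•P≡P : ∀ P → 1 • P ≡ P
  1•P≡P O = refl
  1•P≡P (aff _ _ _) = refl

  •-double : ∀ {N P} → HasOrder N P → 2 ℕ.< N →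
    Σ[ x ∈ ℚ ] Σ[ y ∈ ℚ ] Σ[ x′ ∈ ℚ ] Σ[ y′ ∈ ℚ ] Σ[ h ∈ y * y ≡ cubic x ] Σ[ h′ ∈ y′ * y′ ≡ cubic x′ ]
    (1 • P ≡ aff x y h) × (2 • P ≡ aff x′ y′ h′) × DoublesTo x y x′
  •-double {_} {P} (_ , _ , min) 2<N
    with affine (1 • P) (min 1 (s≤s z≤n) (ℕ.<-trans (s≤s (s≤s z≤n)) 2<N)) | affine (2 • P) (min 2 (s≤s z≤n) 2<N)
  ... | x , y , h , eq | x′ , y′ , h′ , eq′ = x , y , x′ , y′ , h , h′ , eq , eq′ , double x y h (sum eq eq′)
    where
    sum : ∀ {Q R} → 1 • P ≡ Q → 2 • P ≡ R → Q ⊕ Q ≡ R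
    sum refl refl = cong (_⊕ (1 • P)) (1•P≡P P)

  quadruple : ∀ x₁ y₁ .h₁ x₂ y₂ h₂ x₃ y₃ .h₃ {x₄ y₄} .{h₄} →
    let P = aff x₁ y₁ h₁ ; P₂ = aff x₂ y₂ h₂ ; P₃ = aff x₃ y₃ h₃ in
    P ⊕ P ≡ P₂ → P ⊕ P₂ ≡ P₃ → P ⊕ P₃ ≡ aff x₄ y₄ h₄ → DoublesTo x₂ y₂ x₄
  quadruple x₁ y₁ h₁ x₂ y₂ h₂ x₃ y₃ h₃ eq₂ eq₃ eq₄ = line-quadruple
    (⊕-line x₁ y₁ h₁ x₁ y₁ h₁ eq₂) (⊕-line x₁ y₁ h₁ x₂ y₂ h₂ eq₃) (⊕-line x₁ y₁ h₁ x₃ y₃ h₃ eq₄) h₂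
    (λ x₂≡x₁ → contradiction (trans (sym eq₃) (⊕-collision x₁ y₁ h₁ x₁ y₁ h₁ eq₂ x₂≡x₁)) λ ())
    (λ x₃≡x₁ → contradiction (trans (sym eq₄) (⊕-collision x₁ y₁ h₁ x₂ y₂ h₂ eq₃ x₃≡x₁)) λ ())

  -- `4 • P` unfolds to repeated addition of `P`, not to a doubling of `2 • P`; `line-quadruple`
  -- bridges the two on x-coordinates.
  •-quadruple : ∀ {N P} → HasOrder N P → 4 ℕ.< N →
    Σ[ x ∈ ℚ ] Σ[ y ∈ ℚ ] Σ[ x′ ∈ ℚ ] Σ[ y′ ∈ ℚ ] Σ[ h ∈ y * y ≡ cubic x ] Σ[ h′ ∈ y′ * y′ ≡ cubic x′ ]
    (2 • P ≡ aff x y h) × (4 • P ≡ aff x′ y′ h′) × DoublesTo x y x′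
  •-quadruple {_} {P} (_ , _ , min) 4<N
    with affine (1 • P) (min 1 (s≤s z≤n) (ℕ.<-trans (s≤s (s≤s z≤n)) 4<N))
       | affine (2 • P) (min 2 (s≤s z≤n) (ℕ.<-trans (s≤s (s≤s (s≤s z≤n))) 4<N))
       | affine (3 • P) (min 3 (s≤s z≤n) (ℕ.<-trans (s≤s (s≤s (s≤s (s≤s z≤n)))) 4<N))
       | affine (4 • P) (min 4 (s≤s z≤n) 4<N)
  ... | x₁ , y₁ , h₁ , eq₁ | x₂ , y₂ , h₂ , eq₂ | x₃ , y₃ , h₃ , eq₃ | x₄ , y₄ , h₄ , eq₄ =
    x₂ , y₂ , x₄ , y₄ , h₂ , h₄ , eq₂ , eq₄ ,
    quadruple x₁ y₁ h₁ x₂ y₂ h₂ x₃ y₃ h₃ (sum 1 eq₁ eq₁ eq₂) (sum 2 eq₁ eq₂ eq₃) (sum 3 eq₁ eq₃ eq₄)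
    where
    sum : ∀ j {Q R S} → 1 • P ≡ Q → j • P ≡ R → suc j • P ≡ S → Q ⊕ R ≡ S
    sum j refl refl refl = cong (_⊕ (j • P)) (1•P≡P P)

  self-opposite : ∀ {P x y} .{h} → P ≡ aff x y h → P ≡ ⊖ P → x * (x + m) * (x + n) ≡ 0ℚ
  self-opposite {_} {x} {y} {h} refl eq = trans (sym (recompute (y * y ≟ cubic x) h))
    (trans (cong (_* y) y≡0) (*-zeroˡ y))
    where
    y≡0 : y ≡ 0ℚ
    y≡0 = x+x≡0⇒x≡0 (trans (cong (_+ y) (proj₂ (aff-injective eq))) (+-inverseˡ y))

  torsion₄₈ : ∀ {P} → HasOrder 4 P ⊎ HasOrder 8 P →
    Σ[ x ∈ ℚ ] Σ[ y ∈ ℚ ] Σ[ x′ ∈ ℚ ] DoublesTo x y x′ × x′ * (x′ + m) * (x′ + n) ≡ 0ℚ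
  torsion₄₈ (inj₁ ord) =
    let x , y , x′ , _ , _ , _ , _ , eq′ , D = •-double ord (s≤s (s≤s (s≤s z≤n))) in
    x , y , x′ , D , self-opposite eq′ (•-complement ord 2 2 (s≤s z≤n) (s≤s z≤n) refl)
  torsion₄₈ (inj₂ ord) =
    let x , y , x′ , _ , _ , _ , _ , eq′ , D = •-quadruple ord (s≤s (s≤s (s≤s (s≤s (s≤s z≤n))))) in
    x , y , x′ , D , self-opposite eq′ (•-complement ord 4 4 (s≤s z≤n) (s≤s z≤n) refl)

  torsion₃₆ : ∀ {P} → HasOrder 3 P ⊎ HasOrder 6 P → Σ[ x ∈ ℚ ] Σ[ y ∈ ℚ ] DoublesTo x y x
  torsion₃₆ (inj₁ ord) =
    let x , y , x′ , _ , _ , _ , eq , eq′ , D = •-double ord (s≤s (s≤s (s≤s z≤n))) in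
    x , y , subst (DoublesTo x y) (proj₁ (aff-injective
      (trans (sym eq′) (trans (•-complement ord 2 1 (s≤s z≤n) (s≤s z≤n) refl) (cong ⊖_ eq))))) D
  torsion₃₆ (inj₂ ord) =
    let x , y , x′ , _ , _ , _ , eq , eq′ , D = •-quadruple ord (s≤s (s≤s (s≤s (s≤s (s≤s z≤n))))) in
    x , y , subst (DoublesTo x y) (proj₁ (aff-injective
      (trans (sym eq′) (trans (•-complement ord 4 2 (s≤s z≤n) (s≤s z≤n) refl) (cong ⊖_ eq))))) D

-- Integers inside the rationals

ι : ℤ → ℚ
ι i = i / 1

toℚᵘ-ι : ∀ i → toℚᵘ (ι i) ℚᵘ.≃ mkℚᵘ i 0
toℚᵘ-ι i = toℚᵘ-fromℚᵘ (mkℚᵘ i 0)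

-- The equation is checked among unnormalised fractions, where no reduction to lowest terms
-- intervenes, and carried back by injectivity of `toℚᵘ`.
ι-+ : ∀ i j → ι (i ℤ.+ j) ≡ ι i + ι j
ι-+ i j = toℚᵘ-injective (begin
  toℚᵘ (ι (i ℤ.+ j))           ≈⟨ toℚᵘ-ι (i ℤ.+ j) ⟩
  mkℚᵘ (i ℤ.+ j) 0             ≈⟨ *≡* i+j ⟩
  mkℚᵘ i 0 ℚᵘ.+ mkℚᵘ j 0       ≈⟨ ℚᵘ.+-cong (toℚᵘ-ι i) (toℚᵘ-ι j) ⟨
  toℚᵘ (ι i) ℚᵘ.+ toℚᵘ (ι j)   ≈⟨ toℚᵘ-homo-+ (ι i) (ι j) ⟨
  toℚᵘ (ι i + ι j)             ∎)
  where
  open ℚᵘ.≃-Reasoning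
  i+j : (i ℤ.+ j) ℤ.* + 1 ≡ (i ℤ.* + 1 ℤ.+ j ℤ.* + 1) ℤ.* + 1
  i+j = ℤ.solve (i ∷ j ∷ [])

ι-* : ∀ i j → ι (i ℤ.* j) ≡ ι i * ι j
ι-* i j = toℚᵘ-injective (begin
  toℚᵘ (ι (i ℤ.* j))           ≈⟨ toℚᵘ-ι (i ℤ.* j) ⟩
  mkℚᵘ i 0 ℚᵘ.* mkℚᵘ j 0       ≈⟨ ℚᵘ.*-cong (toℚᵘ-ι i) (toℚᵘ-ι j) ⟨
  toℚᵘ (ι i) ℚᵘ.* toℚᵘ (ι j)   ≈⟨ toℚᵘ-homo-* (ι i) (ι j) ⟨
  toℚᵘ (ι i * ι j)             ∎)
  where open ℚᵘ.≃-Reasoning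

ι-injective : ∀ {i j} → ι i ≡ ι j → i ≡ j
ι-injective {i} {j} eq with *≡* i*1≡j*1 ← fromℚᵘ-injective {mkℚᵘ i 0} {mkℚᵘ j 0} eq =
  ℤ.*-cancelʳ-≡ i j (+ 1) i*1≡j*1

ι-↧* : ∀ x → ι (↧ x) * x ≡ ι (↥ x)
ι-↧* x@(mkℚ u d _) = toℚᵘ-injective (begin
  toℚᵘ (ι (↧ x) * x)           ≈⟨ toℚᵘ-homo-* (ι (↧ x)) x ⟩
  toℚᵘ (ι (↧ x)) ℚᵘ.* toℚᵘ x   ≈⟨ ℚᵘ.*-congʳ (toℚᵘ-ι (↧ x)) ⟩
  mkℚᵘ (↧ x) 0 ℚᵘ.* mkℚᵘ u d   ≈⟨ *≡* (cancel (↧ x) u) ⟩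
  mkℚᵘ u 0                     ≈⟨ toℚᵘ-ι u ⟨
  toℚᵘ (ι u)                   ∎)
  where
  open ℚᵘ.≃-Reasoning
  cancel : ∀ v u → v ℤ.* u ℤ.* + 1 ≡ u ℤ.* (+ 1 ℤ.* v)
  cancel v u = ℤ.solve (u ∷ v ∷ [])

ι-neg : ∀ i → ι (ℤ.- i) ≡ - ι i
ι-neg (+ zero)      = refl
ι-neg (+ suc i)     = refl
ι-neg (ℤ.-[1+ i ])  = sym (⁻¹-involutive (ι (+ suc i)))

ι-- : ∀ i j → ι (i ℤ.- j) ≡ ι i - ι j
ι-- i j = trans (ι-+ i (ℤ.- j)) (cong (_+_ (ι i)) (ι-neg j))

x*x≡∣x*x∣ : ∀ x → x * x ≡ ℚ.∣ x * x ∣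
x*x≡∣x*x∣ x with ℚ.∣p∣≡p∨∣p∣≡-p x
... | inj₁ eq = trans (sym (cong₂ _*_ eq eq)) (sym (ℚ.∣p*q∣≡∣p∣*∣q∣ x x))
... | inj₂ eq = trans x*x≡-x*-x (trans (sym (cong₂ _*_ eq eq)) (sym (ℚ.∣p*q∣≡∣p∣*∣q∣ x x)))
  where
  x*x≡-x*-x : x * x ≡ - x * - x
  x*x≡-x*-x = solve (x ∷ []) ring

square≢negative : ∀ x i .{{_ : ℕ.NonZero i}} → x * x ≢ - ι (+ i)
square≢negative x i eq = ℚ.<-irrefl refl (ℚ.<-≤-trans
  (ℚ.neg-antimono-< (ℚ.positive⁻¹ (ι (+ i)) {{ℚ.normalize-pos i 1}}))
  (subst (0ℚ ℚ.≤_) (trans (sym (x*x≡∣x*x∣ x)) eq) (ℚ.0≤∣p∣ (x * x))))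

-- Coprimality and squarefree factors

coprime-* : ∀ {i j d} → Coprime i d → Coprime j d → Coprime (i ℕ.* j) d
coprime-* {i} {j} i⊥d j⊥d (e∣ij , e∣d) = j⊥d
  (coprime-divisor (λ (f∣e , f∣i) → i⊥d (f∣i , ∣-trans f∣e e∣d)) e∣ij , e∣d)

coprime-^ˡ : ∀ {i j} e → Coprime i j → Coprime (i ℕ.^ e) j
coprime-^ˡ zero    i⊥j = Coprimality.1-coprimeTo _
coprime-^ˡ (suc e) i⊥j = coprime-* i⊥j (coprime-^ˡ e i⊥j)

coprime-^ : ∀ {i j} e → Coprime i j → Coprime (i ℕ.^ e) (j ℕ.^ e)
coprime-^ e i⊥j = Coprimality.sym (coprime-^ˡ e (Coprimality.sym (coprime-^ˡ e i⊥j)))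

-- u² divides Pk and Qk, hence k, so u = 1.
squarefree-scaling : ∀ {P Q k u v M N} → Coprime P Q → Squarefree k → Coprime u v →
  v ℕ.* v ℕ.* (P ℕ.* k) ≡ u ℕ.* u ℕ.* M → v ℕ.* v ℕ.* (Q ℕ.* k) ≡ u ℕ.* u ℕ.* N → k ∣ M × k ∣ N
squarefree-scaling {P} {Q} {k} {u} {v} {M} {N} P⊥Q k-sf u⊥v eqP eqQ
  with k-sf u (coprime-factors P⊥Q (u²∣ eqP , u²∣ eqQ))
  where
  u²∣ : ∀ {R L} → v ℕ.* v ℕ.* R ≡ u ℕ.* u ℕ.* L → u ℕ.* u ∣ R
  u²∣ {R} {L} eq = coprime-divisor
    (coprime-* (Coprimality.sym (coprime-* (Coprimality.sym u⊥v) (Coprimality.sym u⊥v)))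
               (Coprimality.sym (coprime-* (Coprimality.sym u⊥v) (Coprimality.sym u⊥v))))
    (subst (u ℕ.* u ∣_) (sym eq) (m∣m*n L))
... | refl = k∣ P eqP , k∣ Q eqQ
  where
  k∣ : ∀ R {L} → v ℕ.* v ℕ.* (R ℕ.* k) ≡ 1 ℕ.* L → k ∣ L
  k∣ R {L} eq = subst (k ∣_) (trans eq (ℕ.*-identityˡ L)) (∣-trans (n∣m*n R) (n∣m*n (v ℕ.* v)))

-- Multiplication by the squared denominator of `l` gives an equation of integers, and absolute
-- values move it to ℕ.
clear-denominator : ∀ l i M → ι (+ i) ≡ l * l * ι M →
  ↧ₙ l ℕ.* ↧ₙ l ℕ.* i ≡ ℤ.∣ ↥ l ∣ ℕ.* ℤ.∣ ↥ l ∣ ℕ.* ℤ.∣ M ∣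
clear-denominator l i M eq = trans (sym (abs-[i²j] (↧ l) (+ i))) (trans
  (cong ℤ.∣_∣ (ι-injective {↧ l ℤ.* ↧ l ℤ.* + i} {↥ l ℤ.* ↥ l ℤ.* M} ι-eq))
  (abs-[i²j] (↥ l) M))
  where
  abs-[i²j] : ∀ i j → ℤ.∣ i ℤ.* i ℤ.* j ∣ ≡ ℤ.∣ i ∣ ℕ.* ℤ.∣ i ∣ ℕ.* ℤ.∣ j ∣
  abs-[i²j] i j = trans (ℤ.abs-* (i ℤ.* i) j) (cong (ℕ._* ℤ.∣ j ∣) (ℤ.abs-* i i))
  ι-[i²j] : ∀ i j → ι (i ℤ.* i ℤ.* j) ≡ ι i * ι i * ι j
  ι-[i²j] i j = trans (ι-* (i ℤ.* i) j) (cong (_* ι j) (ι-* i i))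
  scale : ∀ v u x M → v * l ≡ u → x ≡ l * l * M → v * v * x ≡ u * u * M
  scale v u x M hv hx = combine₂ ((v * l + u) * M) (v * v) hv hx (solve (l ∷ v ∷ u ∷ x ∷ M ∷ []) ring)
  ι-eq : ι (↧ l ℤ.* ↧ l ℤ.* + i) ≡ ι (↥ l ℤ.* ↥ l ℤ.* M)
  ι-eq = trans (ι-[i²j] (↧ l) (+ i)) (trans (scale (ι (↧ l)) (ι (↥ l)) (ι (+ i)) (ι M) (ι-↧* l) eq) (sym (ι-[i²j] (↥ l) M)))

coprime-↥↧ : ∀ l → Coprime ℤ.∣ ↥ l ∣ (↧ₙ l)
coprime-↥↧ (mkℚ _ _ c) = Coprimality.recompute c

scaled-divisibility : ∀ {P Q k} l M N → Coprime P Q → Squarefree k →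
  ι (+ (P ℕ.* k)) ≡ l * l * ι M → ι (+ (Q ℕ.* k)) ≡ l * l * ι N → k ∣ ℤ.∣ M ∣ × k ∣ ℤ.∣ N ∣
scaled-divisibility {P} {Q} {k} l M N P⊥Q k-sf eqP eqQ = squarefree-scaling {v = ↧ₙ l} P⊥Q k-sf (coprime-↥↧ l)
  (clear-denominator l (P ℕ.* k) M eqP) (clear-denominator l (Q ℕ.* k) N eqQ)

-- Squares and quartic forms in coprime integers

-- `a / b` is `x / y` in lowest terms, and `l = y / b`.
common-ratio : ∀ x y → y ≢ 0ℚ → Σ[ l ∈ ℚ ] Σ[ a ∈ ℤ ] Σ[ b ∈ ℤ ]
  Coprime ℤ.∣ a ∣ ℤ.∣ b ∣ × (l * ι a ≡ x) × (l * ι b ≡ y)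
common-ratio x y y≢0 = l , ↥ r , ↧ r , coprime-↥↧ r , l*ιa , l*ιb
  where
  r = _÷_ x y {{≢-nonZero y≢0}}
  ι↧≢0 : ι (↧ r) ≢ 0ℚ
  ι↧≢0 eq = contradiction (ι-injective {↧ r} {+ 0} eq) λ ()
  l = _÷_ y (ι (↧ r)) {{≢-nonZero ι↧≢0}}
  l*ιb : l * ι (↧ r) ≡ y
  l*ιb = x÷y*y≡x y (ι (↧ r)) ι↧≢0
  lemma : ∀ l a b r → l * b ≡ y → b * r ≡ a → r * y ≡ x → l * a ≡ x
  lemma l a b r h₁ h₂ h₃ =
    combine₃ r (- l) 1ℚ h₁ h₂ h₃ (solve (l ∷ a ∷ b ∷ r ∷ x ∷ y ∷ []) ring)
  l*ιa : l * ι (↥ r) ≡ x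
  l*ιa = lemma l (ι (↥ r)) (ι (↧ r)) r l*ιb (ι-↧* r) (x÷y*y≡x x y y≢0)

two-squares : ∀ {P Q k} x y → Coprime P Q → Squarefree k → y ≢ 0ℚ →
  x * x ≡ ι (+ (P ℕ.* k)) → y * y ≡ ι (+ (Q ℕ.* k)) → k ≡ 1
two-squares {P} {Q} {k} x y P⊥Q k-sf y≢0 x² y² =
  let l , a , b , a⊥b , la , lb = common-ratio x y y≢0
      k∣a² , k∣b² = scaled-divisibility {P} {Q} {k} l (a ℤ.* a) (b ℤ.* b) P⊥Q k-sf (scale l a la x²) (scale l b lb y²)
  -- The trailing factor 1 in `square` is the common cofactor that `coprime-factors` extracts from
  -- `a²` and `b²`.
  in ∣1⇒≡1 (coprime-factors (coprime-^ 2 a⊥b) (subst (k ∣_) (square a) k∣a² , subst (k ∣_) (square b) k∣b²))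
  where
  scale : ∀ l {z w} a → l * ι a ≡ z → z * z ≡ w → w ≡ l * l * ι (a ℤ.* a)
  scale l a refl eq = trans (sym eq) (trans (assoc l (ι a)) (cong (l * l *_) (sym (ι-* a a))))
    where
    assoc : ∀ l a → l * a * (l * a) ≡ l * l * (a * a)
    assoc l a = solve (l ∷ a ∷ []) ring
  square : ∀ a → ℤ.∣ a ℤ.* a ∣ ≡ ℤ.∣ a ∣ ℕ.^ 2 ℕ.* 1
  square a = trans (ℤ.abs-* a a) (trans (cong (ℤ.∣ a ∣ ℕ.*_) (sym (ℕ.*-identityʳ _))) (sym (ℕ.*-identityʳ _)))

abs-^ : ∀ i e → ℤ.∣ i ℤ.^ e ∣ ≡ ℤ.∣ i ∣ ℕ.^ e
abs-^ i zero    = refl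
abs-^ i (suc e) = trans (ℤ.abs-* i (i ℤ.^ e)) (cong (ℤ.∣ i ∣ ℕ.*_) (abs-^ i e))

∣-combination : ∀ {i x y z} → i ℤ.∣ x → i ℤ.∣ y → ∀ u v → u ℤ.* x ℤ.+ v ℤ.* y ≡ z → i ℤ.∣ z
∣-combination {i} i∣x i∣y u v eq = subst (i ℤ.∣_) eq (ℤ.∣m∣n⇒∣m+n (ℤ.∣n⇒∣m*n u i∣x) (ℤ.∣n⇒∣m*n v i∣y))

-- The resultant of the binary quartic forms a³(a + 2b) and (a + b)³(b - a) is ± 3,
-- so 3a⁷ and 3b⁷ are integral combinations of them.
∣quartics⇒∣3 : ∀ {k} a b → Coprime ℤ.∣ a ∣ ℤ.∣ b ∣ → k ∣ ℤ.∣ a ℤ.* a ℤ.* a ℤ.* (a ℤ.+ b ℤ.+ b) ∣ →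
  k ∣ ℤ.∣ (a ℤ.+ b) ℤ.* (a ℤ.+ b) ℤ.* (a ℤ.+ b) ℤ.* (b ℤ.- a) ∣ → k ∣ 3
∣quartics⇒∣3 {k} a b a⊥b k∣M k∣N = coprime-factors (coprime-^ 7 a⊥b)
  ( power a (∣-combination k∣ᶻM k∣ᶻN
      (+ 8 ℤ.* b ℤ.* b ℤ.* b ℤ.+ + 12 ℤ.* a ℤ.* b ℤ.* b ℤ.- + 6 ℤ.* a ℤ.* a ℤ.* b ℤ.- + 13 ℤ.* a ℤ.* a ℤ.* a)
      (ℤ.- (+ 16 ℤ.* a ℤ.* a ℤ.* a)) (ℤ.solve (a ∷ b ∷ [])))
  , power b (∣-combination k∣ᶻM k∣ᶻN
      (+ 8 ℤ.* a ℤ.* a ℤ.* a ℤ.+ + 12 ℤ.* a ℤ.* a ℤ.* b ℤ.- + 6 ℤ.* a ℤ.* b ℤ.* b ℤ.- + 13 ℤ.* b ℤ.* b ℤ.* b)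
      (+ 8 ℤ.* a ℤ.* a ℤ.* a ℤ.+ + 12 ℤ.* a ℤ.* a ℤ.* b ℤ.- + 6 ℤ.* a ℤ.* b ℤ.* b ℤ.+ + 3 ℤ.* b ℤ.* b ℤ.* b)
      (ℤ.solve (a ∷ b ∷ []))))
  where
  k∣ᶻM : + k ℤ.∣ a ℤ.* a ℤ.* a ℤ.* (a ℤ.+ b ℤ.+ b)
  k∣ᶻM = ℤ.∣ᵤ⇒∣ k∣M
  k∣ᶻN : + k ℤ.∣ (a ℤ.+ b) ℤ.* (a ℤ.+ b) ℤ.* (a ℤ.+ b) ℤ.* (b ℤ.- a)
  k∣ᶻN = ℤ.∣ᵤ⇒∣ k∣N
  -- The nested product is `c ℤ.^ 7` unfolded, the form that the identities above are solved in.
  power : ∀ c → + k ℤ.∣ (c ℤ.* (c ℤ.* (c ℤ.* (c ℤ.* (c ℤ.* (c ℤ.* (c ℤ.* + 1))))))) ℤ.* + 3 → k ∣ ℤ.∣ c ∣ ℕ.^ 7 ℕ.* 3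
  power c h = subst (k ∣_) (trans (ℤ.abs-* (c ℤ.^ 7) (+ 3)) (cong (ℕ._* 3) (abs-^ c 7))) (ℤ.∣⇒∣ᵤ h)

k∣3⇒k≡1∨3 : ∀ {k} → k ∣ 3 → k ≡ 1 ⊎ k ≡ 3
k∣3⇒k≡1∨3 {0} h = contradiction (0∣⇒≡0 h) λ ()
k∣3⇒k≡1∨3 {1} _ = inj₁ refl
k∣3⇒k≡1∨3 {2} h = contradiction h (from-no (2 ∣? 3))
k∣3⇒k≡1∨3 {3} _ = inj₂ refl
k∣3⇒k≡1∨3 {suc (suc (suc (suc k)))} h = contradiction (∣⇒≤ h) λ { (s≤s (s≤s (s≤s ()))) }

-- The quadratic relation gives `y = - xz / (x + z)`. With `a / b` the ratio `x / z` in lowest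
-- terms, `x = l′a(a + b)`, `y = - l′ab` and `z = l′b(a + b)`, and the differences of squares factor
-- as `l′²` times the two quartics.
three-squares : ∀ {P Q k} x y z → Coprime P Q → Squarefree k → z ≢ 0ℚ → x + z ≢ 0ℚ →
  x * y + x * z + y * z ≡ 0ℚ → ι (+ (P ℕ.* k)) ≡ x * x - y * y → ι (+ (Q ℕ.* k)) ≡ z * z - x * x →
  k ≡ 1 ⊎ k ≡ 3
three-squares {P} {Q} {k} x y z P⊥Q k-sf z≢0 x+z≢0 σ₂≡0 eqP eqQ =
  let l , a , b , a⊥b , la , lb = common-ratio x z z≢0
      l′ , hl′ = divide l (ι a) (ι b) la lb
      k∣M , k∣N = scaled-divisibility {P} {Q} {k} l′ (a ℤ.* a ℤ.* a ℤ.* (a ℤ.+ b ℤ.+ b))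
        ((a ℤ.+ b) ℤ.* (a ℤ.+ b) ℤ.* (a ℤ.+ b) ℤ.* (b ℤ.- a)) P⊥Q k-sf
        (trans eqP (trans (m-form l l′ (ι a) (ι b) hl′ la lb) (cong (l′ * l′ *_) (sym (ι-M a b)))))
        (trans eqQ (trans (n-form l l′ (ι a) (ι b) hl′ la lb) (cong (l′ * l′ *_) (sym (ι-N a b)))))
  in k∣3⇒k≡1∨3 (∣quartics⇒∣3 a b a⊥b k∣M k∣N)
  where
  divide : ∀ l a b → l * a ≡ x → l * b ≡ z → Σ[ l′ ∈ ℚ ] l′ * (a + b) ≡ l
  divide l a b la lb = _÷_ l (a + b) {{≢-nonZero a+b≢0}} , x÷y*y≡x l (a + b) a+b≢0
    where
    a+b≢0 : a + b ≢ 0ℚ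
    a+b≢0 eq = x+z≢0 (combine₃ (- 1ℚ) (- 1ℚ) l la lb eq (solve (l ∷ a ∷ b ∷ x ∷ z ∷ []) ring))
  y≡ : ∀ l l′ a b → l′ * (a + b) ≡ l → l * a ≡ x → l * b ≡ z → y ≡ - (l′ * a * b)
  y≡ _ l′ a b refl refl refl = x*z≡y*z⇒x≡y x+z≢0 (combine₁ 1ℚ σ₂≡0 (solve (y ∷ l′ ∷ a ∷ b ∷ []) ring))
  m-form : ∀ l l′ a b → l′ * (a + b) ≡ l → l * a ≡ x → l * b ≡ z →
           x * x - y * y ≡ l′ * l′ * (a * a * a * (a + b + b))
  m-form l l′ a b hl la lb = trans
    (cong₂ (λ x y → x * x - y * y) (trans (sym la) (cong (_* a) (sym hl))) (y≡ l l′ a b hl la lb)) expand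
    where
    expand : (l′ * (a + b) * a) * (l′ * (a + b) * a) - (- (l′ * a * b)) * (- (l′ * a * b)) ≡
             l′ * l′ * (a * a * a * (a + b + b))
    expand = solve (l′ ∷ a ∷ b ∷ []) ring
  n-form : ∀ l l′ a b → l′ * (a + b) ≡ l → l * a ≡ x → l * b ≡ z →
           z * z - x * x ≡ l′ * l′ * ((a + b) * (a + b) * (a + b) * (b - a))
  n-form _ l′ a b refl refl refl = solve (l′ ∷ a ∷ b ∷ []) ring
  ι-M : ∀ a b → ι (a ℤ.* a ℤ.* a ℤ.* (a ℤ.+ b ℤ.+ b)) ≡ ι a * ι a * ι a * (ι a + ι b + ι b)
  ι-M a b = trans (ι-* (a ℤ.* a ℤ.* a) (a ℤ.+ b ℤ.+ b)) (cong₂ _*_ (ι-cube a)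
    (trans (ι-+ (a ℤ.+ b) b) (cong (_+ ι b) (ι-+ a b))))
    where
    ι-cube : ∀ a → ι (a ℤ.* a ℤ.* a) ≡ ι a * ι a * ι a
    ι-cube a = trans (ι-* (a ℤ.* a) a) (cong (_* ι a) (ι-* a a))
  ι-N : ∀ a b → ι ((a ℤ.+ b) ℤ.* (a ℤ.+ b) ℤ.* (a ℤ.+ b) ℤ.* (b ℤ.- a)) ≡
        (ι a + ι b) * (ι a + ι b) * (ι a + ι b) * (ι b - ι a)
  ι-N a b = trans (ι-* ((a ℤ.+ b) ℤ.* (a ℤ.+ b) ℤ.* (a ℤ.+ b)) (b ℤ.- a)) (cong₂ _*_ ι-cube (ι-- b a))
    where
    ι-cube : ι ((a ℤ.+ b) ℤ.* (a ℤ.+ b) ℤ.* (a ℤ.+ b)) ≡ (ι a + ι b) * (ι a + ι b) * (ι a + ι b)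
    ι-cube = trans (ι-* ((a ℤ.+ b) ℤ.* (a ℤ.+ b)) (a ℤ.+ b))
      (cong₂ _*_ (trans (ι-* (a ℤ.+ b) (a ℤ.+ b)) (cong₂ _*_ (ι-+ a b) (ι-+ a b))) (ι-+ a b))

-- Torsion points and the possible values of k

squarefree⇒nonZero : ∀ {k} → Squarefree k → ℕ.NonZero k
squarefree⇒nonZero {zero}  k-sf = contradiction (k-sf 0 ∣-refl) λ ()
squarefree⇒nonZero {suc k} k-sf = _

-- `m` and `n` are variables tied to the integers by equations, which lets the ring solver treat
-- them as atoms.
module _ {p q k : ℕ} {m n : ℚ} .{{_ : ℕ.NonZero p}} .{{_ : ℕ.NonZero q}}
         (p⊥q : Coprime p q) (k-sf : Squarefree k)
         (m≡ : m ≡ - ι (+ (p ℕ.* k))) (n≡ : n ≡ ι (+ (q ℕ.* k))) where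

  private instance
    k≢0 : ℕ.NonZero k
    k≢0 = squarefree⇒nonZero k-sf
    pk≢0 : ℕ.NonZero (p ℕ.* k)
    pk≢0 = ℕ.m*n≢0 p k
    qk≢0 : ℕ.NonZero (q ℕ.* k)
    qk≢0 = ℕ.m*n≢0 q k

  k≡1 : ∀ {x y x′} → DoublesTo m n x y x′ → x′ * (x′ + m) * (x′ + n) ≡ 0ℚ → k ≡ 1
  k≡1 {x′ = x′} D root = let α , β , γ , α² , β² , γ² , _ = halving-squares m n D in go α β γ α² β² γ²
    where
    go : ∀ α β γ → α * α ≡ x′ → β * β ≡ x′ + m → γ * γ ≡ x′ + n → k ≡ 1
    go α β γ α² β² γ² with x′ ≟ 0ℚ | x′ + m ≟ 0ℚ
    -- `x′ = 0` would make the negative number `m` the square of `β`.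
    ... | yes x′≡0 | _ = contradiction
      (trans β² (trans (cong (_+ m) x′≡0) (trans (+-identityˡ m) m≡))) (square≢negative β (p ℕ.* k))
    -- At `x′ = - m` the squares are `α² = pk` and `γ² = n - m = (p + q)k`.
    ... | no _ | yes x′+m≡0 = two-squares {p} {p ℕ.+ q} α γ
        (Coprimality.sym (Coprimality.coprime-+ (Coprimality.sym p⊥q))) k-sf γ≢0
        (α²≡ (ι (+ (p ℕ.* k))) m≡) γ²≡
      where
      α²≡ : ∀ i → m ≡ - i → α * α ≡ i
      α²≡ i h = combine₃ 1ℚ 1ℚ (- 1ℚ) α² x′+m≡0 h (solve (α ∷ x′ ∷ m ∷ i ∷ []) ring)
      γ²≡i+j : ∀ i j → m ≡ - i → n ≡ j → γ * γ ≡ i + j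
      γ²≡i+j i j h h′ = trans γ² (combine₃ 1ℚ (- 1ℚ) 1ℚ x′+m≡0 h h′ (solve (x′ ∷ m ∷ n ∷ i ∷ j ∷ []) ring))
      γ²≡ : γ * γ ≡ ι (+ ((p ℕ.+ q) ℕ.* k))
      γ²≡ = trans (γ²≡i+j (ι (+ (p ℕ.* k))) (ι (+ (q ℕ.* k))) m≡ n≡)
        (trans (sym (ι-+ (+ (p ℕ.* k)) (+ (q ℕ.* k)))) (cong (λ i → ι (+ i)) (sym (ℕ.*-distribʳ-+ k p q))))
      γ≢0 : γ ≢ 0ℚ
      γ≢0 γ≡0 = ℕ.≢-nonZero⁻¹ (p ℕ.* k) (ℕ.m+n≡0⇒m≡0 (p ℕ.* k) (trans (sym (ℕ.*-distribʳ-+ k p q))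
        (cong ℤ.∣_∣ (ι-injective {+ ((p ℕ.+ q) ℕ.* k)} {+ 0}
          (trans (sym γ²≡) (trans (cong (_* γ) γ≡0) (*-zeroˡ γ)))))))
    -- The remaining root is `x′ = - n`, where `α²` would be negative.
    ... | no x′≢0 | no x′+m≢0 = contradiction (α²≡- (ι (+ (q ℕ.* k))) n≡) (square≢negative α (q ℕ.* k))
      where
      x′+n≡0 : x′ + n ≡ 0ℚ
      x′+n≡0 = x*z≡y*z⇒x≡y x′≢0 (x*z≡y*z⇒x≡y x′+m≢0 (combine₁ 1ℚ root (solve (x′ ∷ m ∷ n ∷ []) ring)))
      α²≡- : ∀ i → n ≡ i → α * α ≡ - i
      α²≡- i h = combine₃ 1ℚ 1ℚ (- 1ℚ) α² x′+n≡0 h (solve (α ∷ x′ ∷ n ∷ i ∷ []) ring)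

  k≡1∨3 : ∀ {x y} → DoublesTo m n x y x → k ≡ 1 ⊎ k ≡ 3
  k≡1∨3 {x} {y} D@record { on-curve = on ; inv = i ; inverse = inverse } =
    let α , β , γ , α² , β² , γ² , prod = halving-squares m n D in go α β γ α² β² γ² prod
    where
    -- `2y` is invertible, so neither `y` nor any factor of the cubic vanishes.
    cubic≢0 : x * (x + m) * (x + n) ≢ 0ℚ
    cubic≢0 eq = contradiction (1≡0 (trans on eq)) λ ()
      where
      1≡0 : y * y ≡ 0ℚ → 1ℚ ≡ 0ℚ
      1≡0 y²≡0 = combine₂ (- ((y + y) * i + 1ℚ)) ((i + i) * (i + i)) inverse y²≡0 (solve (y ∷ i ∷ []) ring)
    x≢0 : x ≢ 0ℚ
    x≢0 x≡0 = cubic≢0 (combine₁ ((x + m) * (x + n)) x≡0 (solve (x ∷ m ∷ n ∷ []) ring))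
    x+n≢0 : x + n ≢ 0ℚ
    x+n≢0 eq = cubic≢0 (combine₁ (x * (x + m)) eq (solve (x ∷ m ∷ n ∷ []) ring))
    go : ∀ α β γ → α * α ≡ x → β * β ≡ x + m → γ * γ ≡ x + n → (α + β) * (α + γ) ≡ x → k ≡ 1 ⊎ k ≡ 3
    go α β γ α² β² γ² prod = three-squares {p} {q} α β γ p⊥q k-sf
      (λ γ≡0 → x+n≢0 (trans (sym γ²) (trans (cong (_* γ) γ≡0) (*-zeroˡ γ))))
      (λ α+γ≡0 → x≢0 (trans (sym prod) (trans (cong ((α + β) *_) α+γ≡0) (*-zeroʳ (α + β)))))
      -- The point doubles to its own x-coordinate, so `(α + β)(α + γ) = x = α²`; subtracting `α²`
      -- leaves the relation.
      (combine₂ 1ℚ (- 1ℚ) prod α² (solve (α ∷ β ∷ γ ∷ x ∷ []) ring))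
      (pk (ι (+ (p ℕ.* k))) m≡) (qk (ι (+ (q ℕ.* k))) n≡)
      where
      pk : ∀ j → m ≡ - j → j ≡ α * α - β * β
      pk j h = combine₃ (- 1ℚ) 1ℚ 1ℚ α² β² h (solve (α ∷ β ∷ x ∷ m ∷ j ∷ []) ring)
      qk : ∀ j → n ≡ j → j ≡ γ * γ - α * α
      qk j h = combine₃ (- 1ℚ) 1ℚ (- 1ℚ) γ² α² h (solve (α ∷ γ ∷ x ∷ n ∷ j ∷ []) ring)

theorem4p1 : (p q k : ℕ) → 0 ℕ.< p → 0 ℕ.< q → Coprime p q → Squarefree k →
  let m = ℤ.- (+ (p ℕ.* k))
      n = + (q ℕ.* k)
  in (ConcordantDueToTorsion 4 m n ⊎ ConcordantDueToTorsion 8 m n → k ≡ 1)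
     × (ConcordantDueToTorsion 3 m n ⊎ ConcordantDueToTorsion 6 m n → k ≡ 1 ⊎ k ≡ 3)
theorem4p1 p q k 0<p 0<q p⊥q k-sf = case-4-8 , case-3-6
  where
  instance
    _ = ℕ.>-nonZero 0<p
    _ = ℕ.>-nonZero 0<q
  m = ℤ.- (+ (p ℕ.* k))
  n = + (q ℕ.* k)
  open Curves (ι m) (ι n) using (HasOrder)
  from-4-8 : ∀ {P} → HasOrder 4 P ⊎ HasOrder 8 P → k ≡ 1
  from-4-8 ord = let _ , _ , _ , D , root = torsion₄₈ (ι m) (ι n) ord in
    k≡1 {p} {q} {k} p⊥q k-sf (ι-neg (+ (p ℕ.* k))) refl D root
  from-3-6 : ∀ {P} → HasOrder 3 P ⊎ HasOrder 6 P → k ≡ 1 ⊎ k ≡ 3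
  from-3-6 ord = let _ , _ , D = torsion₃₆ (ι m) (ι n) ord in
    k≡1∨3 {p} {q} {k} p⊥q k-sf (ι-neg (+ (p ℕ.* k))) refl D
  case-4-8 : ConcordantDueToTorsion 4 m n ⊎ ConcordantDueToTorsion 8 m n → k ≡ 1
  case-4-8 (inj₁ (_ , _ , ord)) = from-4-8 (inj₁ ord)
  case-4-8 (inj₂ (_ , _ , ord)) = from-4-8 (inj₂ ord)
  case-3-6 : ConcordantDueToTorsion 3 m n ⊎ ConcordantDueToTorsion 6 m n → k ≡ 1 ⊎ k ≡ 3
  case-3-6 (inj₁ (_ , _ , ord)) = from-3-6 (inj₁ ord)
  case-3-6 (inj₂ (_ , _ , ord)) = from-3-6 (inj₂ ord)
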